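{- Let $n$ and $r$ be positive integers with $1 \le r < n$. Then the complement graph $C(2n,r)^c$ is non-singular if and only if all of the following conditions hold: 1. $n$ and $r$ have the same parity; 2. $\gcd(n, r+1) = 1$; and 3. the highest power of $2$ dividing $n$ is strictly smaller than the highest power of $2$ dividing $n-r$.
   Context: A graph is called non-singular if its adjacency matrix is non-singular. The complement $X^c$ of a graph $X$ has the same vertex set, and two distinct vertices are adjacent in $X^c$ exactly when they are not adjacent in $X$ (no loops). For a positive integer $m\ge 3$, $C_m$ denotes the cycle graph on $m$ vertices. For $1 \le r < \lfloor m/2 \rfloor$, $C_m^{(r)}$ is the graph with the same vertex set as $C_m$ in which two distinct vertices are adjacent exactly when their distance in $C_m$ is at most $r$. The graph $C_{2n}^{n}$ is the graph on the vertex set of $C_{2n}$ in which two vertices are adjacent exactly when their distance in $C_{2n}$ equals $n$. For $1 \le r < n$, $C(2n,r)$ is the graph on $2n$ vertices whose adjacency matrix is the sum of the adjacency matrices of $C_{2n}^{(r)}$ and $C_{2n}^{n}$. -}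

module Defs where

open import Data.Bool.Base using (if_then_else_)
open import Data.Fin.Base using (Fin; toℕ)
open import Data.Fin.Properties as Fin using (any?)
open import Data.Nat.Base using (ℕ; zero; suc; _*_; _^_; _≤_; _<_; s≤s)
open import Data.Nat.Divisibility using (_∣_)
open import Data.Nat.Properties as ℕ
  using (_≟_; allUpTo?; anyUpTo?; ≤-trans; ≤⇒≯; ≤-antisym; ≮⇒≥; 1+n≢n; n≤1+n; *-monoʳ-≤)
open import Data.Product.Base using (∃-syntax; _×_; _,_)
open import Data.Rational.Base as ℚ using (ℚ; 0ℚ; 1ℚ)
open import Data.Rational.Properties as ℚ using (+-0-commutativeMonoid)
open import Data.Sum.Base as Sum using (_⊎_; inj₁; inj₂; [_,_])
open import Relation.Binary.Definitions using (Decidable; Irreflexive; Symmetric)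
open import Relation.Binary.PropositionalEquality
  using (_≡_; _≢_; refl; sym; trans; cong; subst; ≢-sym)
open import Relation.Nullary.Decidable using (Dec; yes; no; does; map′; ¬?; _×-dec_; _⊎-dec_)
open import Relation.Nullary.Negation using (¬_; contradiction)
open import Algebra.Properties.CommutativeMonoid.Sum +-0-commutativeMonoid using (sum)

------------------------------------------------------------------------
-- Matrices

-- The matrices of interest are 0-1 matrices, and a rational matrix is
-- invertible over ℚ if and only if it is invertible over ℝ or ℂ.
Matrix : ℕ → Set
Matrix m = Fin m → Fin m → ℚ

identity : ∀ {m} → Matrix m
identity i j = if does (i Fin.≟ j) then 1ℚ else 0ℚ

infixl 7 _⊗_
_⊗_ : ∀ {m} → Matrix m → Matrix m → Matrix m
(A ⊗ B) i j = sum λ k → A i k ℚ.* B k j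

infix 4 _≈_
_≈_ : ∀ {m} → Matrix m → Matrix m → Set
A ≈ B = ∀ i j → A i j ≡ B i j

NonSingularMatrix : ∀ {m} → Matrix m → Set
NonSingularMatrix A = ∃[ B ] (A ⊗ B ≈ identity) × (B ⊗ A ≈ identity)

------------------------------------------------------------------------
-- Finite simple graphs

record Graph (m : ℕ) : Set₁ where
  field
    Adj        : Fin m → Fin m → Set
    adj?       : Decidable Adj
    adj-sym    : Symmetric Adj
    adj-irrefl : Irreflexive _≡_ Adj

open Graph public

adjacencyMatrix : ∀ {m} → Graph m → Matrix m
adjacencyMatrix G i j = if does (adj? G i j) then 1ℚ else 0ℚ

NonSingular : ∀ {m} → Graph m → Set
NonSingular G = NonSingularMatrix (adjacencyMatrix G)

complement : ∀ {m} → Graph m → Graph m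
complement G = record
  { Adj        = λ u v → u ≢ v × ¬ Adj G u v
  ; adj?       = λ u v → ¬? (u Fin.≟ v) ×-dec ¬? (adj? G u v)
  ; adj-sym    = λ (u≢v , ¬uv) → ≢-sym u≢v , λ vu → ¬uv (adj-sym G vu)
  ; adj-irrefl = λ u≡v (u≢v , _) → u≢v u≡v
  }

union : ∀ {m} → Graph m → Graph m → Graph m
union G H = record
  { Adj        = λ u v → Adj G u v ⊎ Adj H u v
  ; adj?       = λ u v → adj? G u v ⊎-dec adj? H u v
  ; adj-sym    = Sum.map (adj-sym G) (adj-sym H)
  ; adj-irrefl = λ u≡v → [ adj-irrefl G u≡v , adj-irrefl H u≡v ]
  }

------------------------------------------------------------------------
-- Distance

data Walk {m} (G : Graph m) : ℕ → Fin m → Fin m → Set where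
  []  : ∀ {u} → Walk G 0 u u
  _∷_ : ∀ {k u v w} → Adj G u v → Walk G k v w → Walk G (suc k) u w

-- A shortest walk is a path, so this is the usual distance.
IsDistance : ∀ {m} → Graph m → ℕ → Fin m → Fin m → Set
IsDistance G d u v = Walk G d u v × (∀ {k} → k < d → ¬ Walk G k u v)

module _ {m} (G : Graph m) where

  walk? : ∀ k → Decidable (Walk G k)
  walk? zero    u v = map′ (λ { refl → [] }) (λ { [] → refl }) (u Fin.≟ v)
  walk? (suc k) u w = map′ (λ (_ , a , p) → a ∷ p) (λ { (a ∷ p) → _ , a , p })
    (any? λ v → adj? G u v ×-dec walk? k v w)

  walk-reverse : ∀ {k u v} → Walk G k u v → Walk G k v u
  walk-reverse []      = []
  walk-reverse (a ∷ p) = snoc (walk-reverse p) (adj-sym G a)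
    where
    snoc : ∀ {k u v w} → Walk G k u v → Adj G v w → Walk G (suc k) u w
    snoc []      b = b ∷ []
    snoc (a ∷ p) b = a ∷ snoc p b

  isDistance? : ∀ d → Decidable (IsDistance G d)
  isDistance? d u v = walk? d u v ×-dec allUpTo? (λ k → ¬? (walk? k u v)) d

  isDistance-sym : ∀ {d} → Symmetric (IsDistance G d)
  isDistance-sym (p , shortest) = walk-reverse p , λ k<d q → shortest k<d (walk-reverse q)

  isDistance-unique : ∀ {d e u v} → IsDistance G d u v → IsDistance G e u v → d ≡ e
  isDistance-unique (p , p-min) (q , q-min) =
    ≤-antisym (≮⇒≥ λ e<d → p-min e<d q) (≮⇒≥ λ d<e → q-min d<e p)

  -- Distinct vertices are adjacent when their distance is at most r.
  power : ℕ → Graph m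
  power r = record
    { Adj        = λ u v → u ≢ v × ∃[ d ] d < suc r × IsDistance G d u v
    ; adj?       = λ u v → ¬? (u Fin.≟ v) ×-dec anyUpTo? (λ d → isDistance? d u v) (suc r)
    ; adj-sym    = λ (u≢v , d , d≤r , dist) → ≢-sym u≢v , d , d≤r , isDistance-sym dist
    ; adj-irrefl = λ u≡v (u≢v , _) → u≢v u≡v
    }

  -- Vertices are adjacent when their distance is exactly d.
  exactDistance : ∀ d → 0 < d → Graph m
  exactDistance d 0<d = record
    { Adj        = IsDistance G d
    ; adj?       = isDistance? d
    ; adj-sym    = isDistance-sym
    ; adj-irrefl = λ { refl (_ , shortest) → shortest 0<d [] }
    }

------------------------------------------------------------------------
-- Cycles and the graphs C(2n,r)

-- v is the cyclic successor of u among 0, …, m - 1.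
Next : ∀ {m} → Fin m → Fin m → Set
Next {m} u v = suc (toℕ u) ≡ toℕ v ⊎ (suc (toℕ u) ≡ m × toℕ v ≡ 0)

next? : ∀ {m} → Decidable (Next {m})
next? {m} u v = (suc (toℕ u) ≟ toℕ v) ⊎-dec ((suc (toℕ u) ≟ m) ×-dec (toℕ v ≟ 0))

cycle : ∀ m → 3 ≤ m → Graph m
cycle m 3≤m = record
  { Adj        = λ u v → Next u v ⊎ Next v u
  ; adj?       = λ u v → next? u v ⊎-dec next? v u
  ; adj-sym    = Sum.swap
  ; adj-irrefl = λ { refl → [ ¬next , ¬next ] }
  }
  where
  ¬next : ∀ {u : Fin m} → ¬ Next u u
  ¬next (inj₁ 1+u≡u)         = 1+n≢n 1+u≡u
  ¬next (inj₂ (1+u≡m , u≡0)) =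
    contradiction (subst (3 ≤_) (trans (sym 1+u≡m) (cong suc u≡0)) 3≤m) λ { (s≤s ()) }

module _ (n r : ℕ) (1≤r : 1 ≤ r) (r<n : r < n) where

  3≤2n : 3 ≤ 2 * n
  3≤2n = ≤-trans (n≤1+n 3) (*-monoʳ-≤ 2 (≤-trans (s≤s 1≤r) r<n))

  cyclePower : Graph (2 * n)
  cyclePower = power (cycle (2 * n) 3≤2n) r

  antipodal : Graph (2 * n)
  antipodal = exactDistance (cycle (2 * n) 3≤2n) n (≤-trans 1≤r (ℕ.<⇒≤ r<n))

  C⟨2n,r⟩ : Graph (2 * n)
  C⟨2n,r⟩ = union cyclePower antipodal

  -- The two edge sets are disjoint because r < n, so the union is the
  -- graph whose adjacency matrix is the sum of the two.
  adjacencyMatrix-C⟨2n,r⟩ : ∀ u v →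
    adjacencyMatrix C⟨2n,r⟩ u v ≡ adjacencyMatrix cyclePower u v ℚ.+ adjacencyMatrix antipodal u v
  adjacencyMatrix-C⟨2n,r⟩ u v = indicator (adj? cyclePower u v) (adj? antipodal u v) disjoint
    where
    disjoint : Adj cyclePower u v → ¬ Adj antipodal u v
    disjoint (_ , d , s≤s d≤r , dist) dist′ =
      ≤⇒≯ (subst (_≤ r) (isDistance-unique (cycle (2 * n) 3≤2n) dist dist′) d≤r) r<n

    indicator : ∀ {A B : Set} (a? : Dec A) (b? : Dec B) → (A → ¬ B) →
      (if does (a? ⊎-dec b?) then 1ℚ else 0ℚ) ≡
      (if does a? then 1ℚ else 0ℚ) ℚ.+ (if does b? then 1ℚ else 0ℚ)
    indicator (yes a) (yes b) ¬ab = contradiction b (¬ab a)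
    indicator (yes _) (no _)  _   = refl
    indicator (no _)  (yes _) _   = refl
    indicator (no _)  (no _)  _   = refl

------------------------------------------------------------------------
-- The highest power of 2 dividing a number

-- No p satisfies this for n = 0; for n > 0 exactly one does.
record IsHighestPowerOf2Dividing (p n : ℕ) : Set where
  field
    isPower : ∃[ k ] p ≡ 2 ^ k
    divides : p ∣ n
    highest : ∀ k → 2 ^ k ∣ n → 2 ^ k ≤ p

{-# OPTIONS --safe #-}

-- Put N = 2n and m = n − r − 1, and let x be the cyclic shift of ℤ/N. The adjacency matrix of
-- C(2n,r)ᶜ is the circulant x^(r+1) (1 + x^(m+1)) (1 + x + ⋯ + x^(m-1)), acting on N-periodic
-- sequences.
--
-- If 2^l is the highest power of 2 dividing m + 1 = n − r and it divides n, then 1 + x^(m+1)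
-- kills i ↦ (−1)^⌊i/2^l⌋. If d = gcd(n, r+1) ≠ 1, then d divides m and the last factor kills
-- i ↦ [d ∣ i+1] − [d ∣ i].
--
-- Otherwise both factors are invertible: the odd part t of n makes t (m + 1) a multiple of N, so
-- x^(m+1) has odd order, and m, being odd and coprime to n, is invertible modulo N.
module Submission where

open import Algebra.Bundles using (CommutativeRing)
open import Data.Bool.Base using (if_then_else_)
open import Data.Fin.Base as Fin using (Fin; toℕ)
import Data.Fin.Properties as Fin
open import Data.Nat.Base as ℕ
  using (ℕ; zero; suc; pred; _+_; _*_; _∸_; _^_; _≤_; _<_; s≤s; z≤n; parity; NonZero)
open import Data.Nat.Coprimality using (Coprime; coprime-divisor; coprime-Bézout; gcd≡1⇒coprime)
open import Data.Nat.Divisibility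
open import Data.Nat.DivMod
open import Data.Nat.GCD using (gcd; gcd[m,n]∣m; gcd[m,n]∣n; module Bézout)
open import Data.Nat.Induction using (<-rec)
import Data.Nat.Properties as ℕ
import Data.Nat.Solver
open import Data.Parity.Base as ℙ using (Parity; 0ℙ; 1ℙ)
import Data.Parity.Properties as ℙ
open import Data.Product.Base using (_×_; ∃-syntax; _,_; proj₁; proj₂)
open import Data.Rational.Base as ℚ using (ℚ; 0ℚ; 1ℚ; ½; _-_; -_; 1/_)
open import Data.Rational.Properties hiding (0/n≡0)
open import Data.Rational.Solver using (module +-*-Solver)
open import Data.Sum.Base using (inj₁; inj₂)
open import Function.Base using (_∘_)
open import Function.Bundles using (_⇔_; mk⇔)
open import Relation.Binary.PropositionalEquality
open import Relation.Nullary.Decidable using (Dec; does; does-⇔; yes; no; dec-true; dec-false)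
open import Relation.Nullary.Negation using (¬_; contradiction)
open import Algebra.Properties.Semiring.Sum (CommutativeRing.semiring +-*-commutativeRing)
  using (sum; sum-cong-≗; sum-replicate-zero; ∑-comm; ∑-distrib-+; *-distribˡ-sum; *-distribʳ-sum)
open import Defs
open ≡-Reasoning
open +-*-Solver using (solve; _:+_; _:*_; _:-_; :-_; _:=_; con)
open Data.Nat.Solver.+-*-Solver using (Polynomial)
  renaming (solve to solveℕ; _:+_ to _⊞_; _:*_ to _⊠_; _:=_ to _⊜_; con to conℕ)

-- Sums and periodic sequences

∑< : ℕ → (ℕ → ℚ) → ℚ
∑< n f = sum {n} (f ∘ toℕ)

∑<-cong : ∀ n {f g} → (∀ k → k < n → f k ≡ g k) → ∑< n f ≡ ∑< n g
∑<-cong n f≗g = sum-cong-≗ {n} λ i → f≗g (toℕ i) (Fin.toℕ<n i)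

∑<-zero : ∀ n {f} → (∀ k → k < n → f k ≡ 0ℚ) → ∑< n f ≡ 0ℚ
∑<-zero n f≗0 = trans (∑<-cong n f≗0) (sum-replicate-zero n)

∑<-split : ∀ m n f → ∑< (m + n) f ≡ ∑< m f ℚ.+ ∑< n (λ k → f (m + k))
∑<-split zero    n f = sym (+-identityˡ _)
∑<-split (suc m) n f = trans (cong (f 0 ℚ.+_) (∑<-split m n (f ∘ suc))) (sym (+-assoc (f 0) _ _))

∑<-last : ∀ n f → ∑< (suc n) f ≡ ∑< n f ℚ.+ f n
∑<-last zero    f = +-comm (f 0) 0ℚ
∑<-last (suc n) f = trans (cong (f 0 ℚ.+_) (∑<-last n (f ∘ suc))) (sym (+-assoc (f 0) _ _))

∑<-product : ∀ m n f → ∑< (m * n) f ≡ ∑< m λ k → ∑< n λ l → f (k * n + l)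
∑<-product zero    n f = refl
∑<-product (suc m) n f = begin
  ∑< (n + m * n) f
    ≡⟨ ∑<-split n (m * n) f ⟩
  ∑< n f ℚ.+ ∑< (m * n) (λ j → f (n + j))
    ≡⟨ cong (∑< n f ℚ.+_) (∑<-product m n (λ j → f (n + j))) ⟩
  ∑< n f ℚ.+ ∑< m (λ k → ∑< n λ l → f (n + (k * n + l)))
    ≡⟨ cong (∑< n f ℚ.+_) (∑<-cong m λ k _ → ∑<-cong n λ l _ → cong f (sym (ℕ.+-assoc n (k * n) l))) ⟩
  ∑< n f ℚ.+ ∑< m (λ k → ∑< n λ l → f (n + k * n + l)) ∎

∑<-telescope : ∀ n (f : ℕ → ℚ) → ∑< n (λ k → f (suc k) - f k) ≡ f n - f 0
∑<-telescope zero    f = sym (+-inverseʳ (f 0))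
∑<-telescope (suc n) f = trans (cong ((f 1 - f 0) ℚ.+_) (∑<-telescope n (f ∘ suc)))
  (solve 3 (λ x y z → (y :- x) :+ (z :- y) := z :- x) refl (f 0) (f 1) (f (suc n)))

Periodic : ℕ → (ℕ → ℚ) → Set
Periodic p f = ∀ i → f (i + p) ≡ f i

periodic-multiple : ∀ {p f} k → Periodic p f → Periodic (k * p) f
periodic-multiple {p} {f} zero    per i = cong f (ℕ.+-identityʳ i)
periodic-multiple {p} {f} (suc k) per i =
  trans (cong f (sym (ℕ.+-assoc i p (k * p)))) (trans (periodic-multiple k per (i + p)) (per i))

periodic-shift : ∀ {p f} k → Periodic p f → Periodic p (λ i → f (i + k))
periodic-shift {p} {f} k per i = begin
  f (i + p + k)   ≡⟨ cong f (ℕ.+-assoc i p k) ⟩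
  f (i + (p + k)) ≡⟨ cong (λ j → f (i + j)) (ℕ.+-comm p k) ⟩
  f (i + (k + p)) ≡⟨ cong f (ℕ.+-assoc i k p) ⟨
  f (i + k + p)   ≡⟨ per (i + k) ⟩
  f (i + k)       ∎

periodic-∑< : ∀ {p} n {F : ℕ → ℕ → ℚ} → (∀ k → Periodic p (F k)) →
  Periodic p (λ i → ∑< n λ k → F k i)
periodic-∑< n per i = ∑<-cong n λ k _ → per k i

-- The window of length `p + 1` starting at `i` is `f i` followed by the window at `suc i`, and also
-- the window at `i` followed by `f (i + p)`. Periodicity makes the two extra terms equal, so they
-- cancel.
∑<-rotate : ∀ {p f} i → Periodic p f → ∑< p (λ k → f (i + k)) ≡ ∑< p f
∑<-rotate         zero    per = refl
∑<-rotate {p} {f} (suc i) per = trans (+-cancelˡ (f i) _ _ shift) (∑<-rotate i per)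
  where
  +-cancelˡ : ∀ x y z → x ℚ.+ y ≡ x ℚ.+ z → y ≡ z
  +-cancelˡ x y z eq = trans (recover x y) (trans (cong (- x ℚ.+_) eq) (sym (recover x z)))
    where
    recover : ∀ x y → y ≡ - x ℚ.+ (x ℚ.+ y)
    recover = solve 2 (λ x y → y := (:- x) :+ (x :+ y)) refl

  shift : f i ℚ.+ ∑< p (λ k → f (suc i + k)) ≡ f i ℚ.+ ∑< p (λ k → f (i + k))
  shift = begin
    f i ℚ.+ ∑< p (λ k → f (suc i + k))
      ≡⟨ cong₂ ℚ._+_ (cong f (sym (ℕ.+-identityʳ i))) (∑<-cong p λ k _ → cong f (sym (ℕ.+-suc i k))) ⟩
    ∑< (suc p) (λ k → f (i + k))
      ≡⟨ ∑<-last p (λ k → f (i + k)) ⟩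
    ∑< p (λ k → f (i + k)) ℚ.+ f (i + p)
      ≡⟨ cong (∑< p (λ k → f (i + k)) ℚ.+_) (per i) ⟩
    ∑< p (λ k → f (i + k)) ℚ.+ f i
      ≡⟨ +-comm _ (f i) ⟩
    f i ℚ.+ ∑< p (λ k → f (i + k)) ∎

-- A sum of `suc m` ones is a positive rational `q`, so a constant sequence can be scaled to reach
-- any sum.
∑<-const-solvable : ∀ m y → ∃[ x ] ∑< (suc m) (λ _ → x) ≡ y
∑<-const-solvable m y = (1/ q) ℚ.* y , (begin
  ∑< (suc m) (λ _ → (1/ q) ℚ.* y)          ≡⟨ ∑<-cong (suc m) (λ _ _ → sym (*-identityˡ ((1/ q) ℚ.* y))) ⟩
  ∑< (suc m) (λ _ → 1ℚ ℚ.* ((1/ q) ℚ.* y)) ≡⟨ *-distribʳ-sum {suc m} ((1/ q) ℚ.* y) (λ _ → 1ℚ) ⟨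
  q ℚ.* ((1/ q) ℚ.* y)                     ≡⟨ *-assoc q (1/ q) y ⟨
  q ℚ.* (1/ q) ℚ.* y                       ≡⟨ cong (ℚ._* y) (*-inverseʳ q) ⟩
  1ℚ ℚ.* y                                 ≡⟨ *-identityˡ y ⟩
  y                                        ∎)
  where
  q = ∑< (suc m) (λ _ → 1ℚ)

  nonNegative : ∀ m → ℚ.NonNegative (∑< m (λ _ → 1ℚ))
  nonNegative zero    = _
  nonNegative (suc m) = nonNeg+nonNeg⇒nonNeg 1ℚ (∑< m (λ _ → 1ℚ)) {{nonNegative m}}

  instance
    q≢0 : ℚ.NonZero q
    q≢0 = pos⇒nonZero q {{pos+nonNeg⇒pos 1ℚ (∑< m (λ _ → 1ℚ)) {{nonNegative m}}}}

-- Matrices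

infixr 7 _▹_
_▹_ : ∀ {m} → Matrix m → (Fin m → ℚ) → Fin m → ℚ
(A ▹ x) i = sum λ j → A i j ℚ.* x j

▹-congʳ : ∀ {m} (A : Matrix m) {x y} → (∀ j → x j ≡ y j) → ∀ i → (A ▹ x) i ≡ (A ▹ y) i
▹-congʳ A x≗y i = sum-cong-≗ λ j → cong (A i j ℚ.*_) (x≗y j)

▹-congˡ : ∀ {m} {A B : Matrix m} x → A ≈ B → ∀ i → (A ▹ x) i ≡ (B ▹ x) i
▹-congˡ x A≈B i = sum-cong-≗ λ j → cong (ℚ._* x j) (A≈B i j)

▹-zero : ∀ {m} (A : Matrix m) i → (A ▹ λ _ → 0ℚ) i ≡ 0ℚ
▹-zero {m} A i = trans (sum-cong-≗ λ j → *-zeroʳ (A i j)) (sum-replicate-zero m)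

⊗-▹ : ∀ {m} (A B : Matrix m) x i → ((A ⊗ B) ▹ x) i ≡ (A ▹ B ▹ x) i
⊗-▹ A B x i = begin
  sum (λ k → sum (λ j → A i j ℚ.* B j k) ℚ.* x k)
    ≡⟨ sum-cong-≗ (λ k → *-distribʳ-sum (x k) (λ j → A i j ℚ.* B j k)) ⟩
  sum (λ k → sum (λ j → A i j ℚ.* B j k ℚ.* x k))
    ≡⟨ ∑-comm (λ k j → A i j ℚ.* B j k ℚ.* x k) ⟩
  sum (λ j → sum (λ k → A i j ℚ.* B j k ℚ.* x k))
    ≡⟨ sum-cong-≗ (λ j → sum-cong-≗ λ k → *-assoc (A i j) (B j k) (x k)) ⟩
  sum (λ j → sum (λ k → A i j ℚ.* (B j k ℚ.* x k)))
    ≡⟨ sum-cong-≗ (λ j → sym (*-distribˡ-sum (A i j) (λ k → B j k ℚ.* x k))) ⟩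
  sum (λ j → A i j ℚ.* (B ▹ x) j) ∎

identity-▹ : ∀ {m} (x : Fin m → ℚ) i → (identity ▹ x) i ≡ x i
identity-▹ {suc m} x Fin.zero = begin
  1ℚ ℚ.* x Fin.zero ℚ.+ sum (λ j → 0ℚ ℚ.* x (Fin.suc j))
    ≡⟨ cong₂ ℚ._+_ (*-identityˡ (x Fin.zero)) (trans
         (sum-cong-≗ λ j → *-zeroˡ (x (Fin.suc j))) (sum-replicate-zero m)) ⟩
  x Fin.zero ℚ.+ 0ℚ
    ≡⟨ +-identityʳ _ ⟩
  x Fin.zero ∎
identity-▹ {suc m} x (Fin.suc i) = begin
  0ℚ ℚ.* x Fin.zero ℚ.+ (identity ▹ (x ∘ Fin.suc)) i
    ≡⟨ cong₂ ℚ._+_ (*-zeroˡ (x Fin.zero)) (identity-▹ (x ∘ Fin.suc) i) ⟩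
  0ℚ ℚ.+ x (Fin.suc i)
    ≡⟨ +-identityˡ _ ⟩
  x (Fin.suc i) ∎

identity-sym : ∀ {m} (i j : Fin m) → identity i j ≡ identity j i
identity-sym i j = cong (if_then 1ℚ else 0ℚ) (does-⇔ (mk⇔ sym sym) (i Fin.≟ j) (j Fin.≟ i))

kernel-trivial : ∀ {m} {A : Matrix m} → NonSingularMatrix A →
  ∀ x → (∀ i → (A ▹ x) i ≡ 0ℚ) → ∀ i → x i ≡ 0ℚ
kernel-trivial {A = A} (B , _ , BA≈I) x Ax≡0 i = begin
  x i              ≡⟨ identity-▹ x i ⟨
  (identity ▹ x) i ≡⟨ ▹-congˡ x BA≈I i ⟨
  ((B ⊗ A) ▹ x) i  ≡⟨ ⊗-▹ B A x i ⟩
  (B ▹ A ▹ x) i    ≡⟨ ▹-congʳ B Ax≡0 i ⟩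
  (B ▹ λ _ → 0ℚ) i ≡⟨ ▹-zero B i ⟩
  0ℚ               ∎

-- By symmetry the transpose of a right inverse is a left inverse, and the two then agree.
symmetric∧surjective⇒nonSingular : ∀ {m} {A : Matrix m} → (∀ i j → A i j ≡ A j i) →
  (∀ y → ∃[ x ] ∀ i → (A ▹ x) i ≡ y i) → NonSingularMatrix A
symmetric∧surjective⇒nonSingular {m} {A} A-sym surjective = B , AB≈I , BA≈I
  where
  column : (j : Fin m) → ∃[ x ] ∀ i → (A ▹ x) i ≡ identity i j
  column j = surjective λ i → identity i j

  B Bᵗ : Matrix m
  B  i j = proj₁ (column j) i
  Bᵗ i j = B j i

  AB≈I : A ⊗ B ≈ identity
  AB≈I i j = proj₂ (column j) i

  BᵗA≈I : Bᵗ ⊗ A ≈ identity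
  BᵗA≈I i j = begin
    sum (λ k → B k i ℚ.* A k j)
      ≡⟨ sum-cong-≗ (λ k → trans (*-comm (B k i) (A k j)) (cong (ℚ._* B k i) (A-sym k j))) ⟩
    (A ⊗ B) j i
      ≡⟨ AB≈I j i ⟩
    identity j i
      ≡⟨ identity-sym j i ⟩
    identity i j ∎

  B≈Bᵗ : B ≈ Bᵗ
  B≈Bᵗ i j = begin
    B i j                      ≡⟨ identity-▹ (λ k → B k j) i ⟨
    (identity ▹ λ k → B k j) i ≡⟨ ▹-congˡ (λ k → B k j) BᵗA≈I i ⟨
    ((Bᵗ ⊗ A) ▹ λ k → B k j) i ≡⟨ ⊗-▹ Bᵗ A (λ k → B k j) i ⟩
    (Bᵗ ▹ λ k → (A ⊗ B) k j) i ≡⟨ ▹-congʳ Bᵗ (λ k → AB≈I k j) i ⟩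
    sum (λ k → B k i ℚ.* identity k j)
                                      ≡⟨ sum-cong-≗ (λ k → trans (*-comm (B k i) (identity k j))
                                                                 (cong (ℚ._* B k i) (identity-sym k j))) ⟩
    (identity ▹ λ k → B k i) j ≡⟨ identity-▹ (λ k → B k i) j ⟩
    B j i                      ∎

  BA≈I : B ⊗ A ≈ identity
  BA≈I i j = trans (▹-congˡ (λ k → A k j) B≈Bᵗ i) (BᵗA≈I i j)

adjacencyMatrix-sym : ∀ {m} (G : Graph m) i j → adjacencyMatrix G i j ≡ adjacencyMatrix G j i
adjacencyMatrix-sym G i j = cong (if_then 1ℚ else 0ℚ)
  (does-⇔ (mk⇔ (adj-sym G) (adj-sym G)) (adj? G i j) (adj? G j i))

-- Residues and walks in a cycle

module _ {N : ℕ} .{{_ : NonZero N}} where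

  infix 4 _≋_
  _≋_ : ℕ → ℕ → Set
  x ≋ y = x % N ≡ y % N

  +-congʳ-≋ : ∀ {x y} z → x ≋ y → x + z ≋ y + z
  +-congʳ-≋ {x} {y} z x≋y = begin
    (x + z) % N         ≡⟨ %-distribˡ-+ x z N ⟩
    (x % N + z % N) % N ≡⟨ cong (λ w → (w + z % N) % N) x≋y ⟩
    (y % N + z % N) % N ≡⟨ %-distribˡ-+ y z N ⟨
    (y + z) % N         ∎

  suc-≋ : ∀ {x y} → x ≋ y → suc x ≋ suc y
  suc-≋ {x} {y} x≋y = subst₂ _≋_ (ℕ.+-comm x 1) (ℕ.+-comm y 1) (+-congʳ-≋ 1 x≋y)

  -- Modulo `N`, `i * pred N` is the negative of `i`; adding it to both sides removes `i`.
  +-cancelˡ-≋ : ∀ i {x y} → i + x ≋ i + y → x ≋ y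
  +-cancelˡ-≋ i {x} {y} eq = trans (sym (wrap x)) (trans (+-congʳ-≋ (i * pred N) eq) (wrap y))
    where
    wrap : ∀ z → i + z + i * pred N ≋ z
    wrap z = begin
      (i + z + i * pred N) % N   ≡⟨ cong (λ w → (w + i * pred N) % N) (ℕ.+-comm i z) ⟩
      (z + i + i * pred N) % N   ≡⟨ cong (_% N) (ℕ.+-assoc z i (i * pred N)) ⟩
      (z + (i + i * pred N)) % N ≡⟨ cong (λ w → (z + w) % N) (ℕ.*-suc i (pred N)) ⟨
      (z + i * suc (pred N)) % N ≡⟨ cong (λ w → (z + i * w) % N) (ℕ.suc-pred N) ⟩
      (z + i * N) % N            ≡⟨ [m+kn]%n≡m%n z i N ⟩
      z % N                      ∎

  ≋⇒≡ : ∀ {x y} → x < N → y < N → x ≋ y → x ≡ y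
  ≋⇒≡ x<N y<N x≋y = trans (sym (m<n⇒m%n≡m x<N)) (trans x≋y (m<n⇒m%n≡m y<N))

  toℕ-mod : ∀ x → toℕ (x mod N) ≡ x % N
  toℕ-mod x = Fin.toℕ-fromℕ< (m%n<n x N)

  mod-cong : ∀ {x y} → x ≋ y → x mod N ≡ y mod N
  mod-cong {x} {y} x≋y = Fin.toℕ-injective (trans (toℕ-mod x) (trans x≋y (sym (toℕ-mod y))))

  mod-toℕ : ∀ (u : Fin N) → toℕ u mod N ≡ u
  mod-toℕ u = Fin.toℕ-injective (trans (toℕ-mod (toℕ u)) (m<n⇒m%n≡m (Fin.toℕ<n u)))

  toℕ-mod-≋ : ∀ x → toℕ (x mod N) ≋ x
  toℕ-mod-≋ x = trans (cong (_% N) (toℕ-mod x)) (m%n%n≡m%n x N)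

  periodic-mod : (y : Fin N → ℚ) → Periodic N (λ i → y (i mod N))
  periodic-mod y i = cong y (mod-cong ([m+n]%n≡m%n i N))

  -- Indexes a row by the offset `d` from the diagonal, the form in which a circulant has the same
  -- coefficients in every row. The summand is `N`-periodic in the column, so the summation may
  -- start at `i`.
  ▹-rotate : ∀ (A : Matrix N) {g} → Periodic N g → ∀ i →
    (A ▹ (g ∘ toℕ)) (i mod N) ≡ ∑< N (λ d → A (i mod N) ((i + d) mod N) ℚ.* g (i + d))
  ▹-rotate A {g} per i = begin
    sum (λ j → A (i mod N) j ℚ.* g (toℕ j))
      ≡⟨ sum-cong-≗ (λ j → cong (λ v → A (i mod N) v ℚ.* g (toℕ j)) (sym (mod-toℕ j))) ⟩
    ∑< N (λ j → A (i mod N) (j mod N) ℚ.* g j)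
      ≡⟨ ∑<-rotate i (λ j → cong₂ ℚ._*_ (periodic-mod (A (i mod N)) j) (per j)) ⟨
    ∑< N (λ d → A (i mod N) ((i + d) mod N) ℚ.* g (i + d)) ∎

  Next⇒≋ : ∀ {u v : Fin N} → Next u v → suc (toℕ u) ≋ toℕ v
  Next⇒≋ (inj₁ 1+u≡v)         = cong (_% N) 1+u≡v
  Next⇒≋ {u} {v} (inj₂ (1+u≡N , v≡0)) = begin
    suc (toℕ u) % N ≡⟨ cong (_% N) 1+u≡N ⟩
    N % N           ≡⟨ [m+n]%n≡m%n 0 N ⟩
    0 % N           ≡⟨ cong (_% N) v≡0 ⟨
    toℕ v % N       ∎

  Next-mod : ∀ x → Next (x mod N) (suc x mod N)
  Next-mod x with ℕ.m≤n⇒m<n∨m≡n (m%n<n x N)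
  ... | inj₁ 1+x%N<N = inj₁ (begin
    suc (toℕ (x mod N)) ≡⟨ cong suc (toℕ-mod x) ⟩
    suc (x % N)         ≡⟨ m<n⇒m%n≡m 1+x%N<N ⟨
    suc (x % N) % N     ≡⟨ suc-≋ (m%n%n≡m%n x N) ⟩
    suc x % N           ≡⟨ toℕ-mod (suc x) ⟨
    toℕ (suc x mod N)   ∎)
  ... | inj₂ 1+x%N≡N = inj₂ (trans (cong suc (toℕ-mod x)) 1+x%N≡N , (begin
    toℕ (suc x mod N) ≡⟨ toℕ-mod (suc x) ⟩
    suc x % N         ≡⟨ suc-≋ (m%n%n≡m%n x N) ⟨
    suc (x % N) % N   ≡⟨ cong (_% N) 1+x%N≡N ⟩
    N % N             ≡⟨ n%n≡0 N ⟩
    0                 ∎))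

-- Strong induction on the length: having a shorter walk is decidable, so either the induction
-- applies to one or the given walk is already shortest.
walk⇒distance : ∀ {m} (G : Graph m) {u v} k → Walk G k u v → ∃[ d ] d ≤ k × IsDistance G d u v
walk⇒distance G {u} {v} = <-rec _ λ k rec w → case k rec w (ℕ.anyUpTo? (λ j → walk? G j u v) k)
  where
  case : ∀ k → (∀ {j} → j < k → Walk G j u v → ∃[ d ] d ≤ j × IsDistance G d u v) →
    Walk G k u v → Dec (∃[ j ] j < k × Walk G j u v) → ∃[ d ] d ≤ k × IsDistance G d u v
  case k rec w (yes (j , j<k , w′)) =
    let d , d≤j , dist = rec j<k w′ in d , ℕ.≤-trans d≤j (ℕ.<⇒≤ j<k) , dist
  case k rec w (no ∄shorter) = k , ℕ.≤-refl , w , λ {j} j<k w′ → ∄shorter (j , j<k , w′)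

module _ {N : ℕ} .{{_ : NonZero N}} (3≤N : 3 ≤ N) where

  -- a counts the forward steps of the walk and b the backward steps.
  walk⇒≋ : ∀ {k} {u v : Fin N} → Walk (cycle N 3≤N) k u v →
    ∃[ a ] ∃[ b ] a + b ≡ k × _≋_ {N} (toℕ u + a) (toℕ v + b)
  walk⇒≋ [] = 0 , 0 , refl , refl
  walk⇒≋ {u = u} {w} (_∷_ {v = v} uv p) with walk⇒≋ p | uv
  ... | a , b , a+b≡k , v+a≋w+b | inj₁ u→v = suc a , b , cong suc a+b≡k , (begin
    (toℕ u + suc a) % N   ≡⟨ cong (_% N) (ℕ.+-suc (toℕ u) a) ⟩
    (suc (toℕ u) + a) % N ≡⟨ +-congʳ-≋ a (Next⇒≋ u→v) ⟩
    (toℕ v + a) % N       ≡⟨ v+a≋w+b ⟩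
    (toℕ w + b) % N       ∎)
  ... | a , b , a+b≡k , v+a≋w+b | inj₂ v→u = a , suc b , trans (ℕ.+-suc a b) (cong suc a+b≡k) , (begin
    (toℕ u + a) % N     ≡⟨ +-congʳ-≋ a (Next⇒≋ v→u) ⟨
    suc (toℕ v + a) % N ≡⟨ suc-≋ v+a≋w+b ⟩
    suc (toℕ w + b) % N ≡⟨ cong (_% N) (ℕ.+-suc (toℕ w) b) ⟨
    (toℕ w + suc b) % N ∎)

  walk-forward : ∀ d x → Walk (cycle N 3≤N) d (x mod N) ((x + d) mod N)
  walk-forward zero    x = subst (λ y → Walk (cycle N 3≤N) 0 (x mod N) (y mod N)) (sym (ℕ.+-identityʳ x)) []
  walk-forward (suc d) x = inj₁ (Next-mod x) ∷
    subst (λ y → Walk (cycle N 3≤N) d (suc x mod N) (y mod N)) (sym (ℕ.+-suc x d)) (walk-forward d (suc x))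

  -- Going forward `N ∸ d` more steps from `x + d` closes the cycle at `x`; the walk is that one
  -- reversed.
  walk-backward : ∀ {d} → d ≤ N → ∀ x → Walk (cycle N 3≤N) (N ∸ d) (x mod N) ((x + d) mod N)
  walk-backward {d} d≤N x = walk-reverse (cycle N 3≤N)
    (subst (Walk _ (N ∸ d) ((x + d) mod N)) (mod-cong returns) (walk-forward (N ∸ d) (x + d)))
    where
    returns : _≋_ {N} (x + d + (N ∸ d)) x
    returns = begin
      (x + d + (N ∸ d)) % N   ≡⟨ cong (_% N) (ℕ.+-assoc x d (N ∸ d)) ⟩
      (x + (d + (N ∸ d))) % N ≡⟨ cong (λ w → (x + w) % N) (ℕ.m+[n∸m]≡n d≤N) ⟩
      (x + N) % N             ≡⟨ [m+n]%n≡m%n x N ⟩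
      x % N                   ∎

  -- With `a` forward and `b` backward steps, `a` and `d + b` agree modulo `N`. The bound
  -- `d + k < N` puts both below `N`, so they are equal and `d ≤ a ≤ k`. It thereby excludes walks
  -- that go round the other side.
  walk-length : ∀ {k d} x → Walk (cycle N 3≤N) k (x mod N) ((x + d) mod N) → d + k < N → d ≤ k
  walk-length {k} {d} x w d+k<N with walk⇒≋ w
  ... | a , b , refl , u+a≋v+b =
    ℕ.≤-trans (ℕ.m≤m+n d b) (ℕ.≤-trans (ℕ.≤-reflexive (sym a≡d+b)) (ℕ.m≤m+n a b))
    where
    x+a≋x+d+b : _≋_ {N} (x + a) (x + (d + b))
    x+a≋x+d+b = begin
      (x + a) % N                   ≡⟨ +-congʳ-≋ a (toℕ-mod-≋ x) ⟨
      (toℕ (x mod N) + a) % N       ≡⟨ u+a≋v+b ⟩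
      (toℕ ((x + d) mod N) + b) % N ≡⟨ +-congʳ-≋ b (toℕ-mod-≋ (x + d)) ⟩
      (x + d + b) % N               ≡⟨ cong (_% N) (ℕ.+-assoc x d b) ⟩
      (x + (d + b)) % N             ∎

    a≡d+b : a ≡ d + b
    a≡d+b = ≋⇒≡
      (ℕ.≤-<-trans (ℕ.≤-trans (ℕ.m≤m+n a b) (ℕ.m≤n+m (a + b) d)) d+k<N)
      (ℕ.≤-<-trans (ℕ.+-monoʳ-≤ d (ℕ.m≤n+m b a)) d+k<N)
      (+-cancelˡ-≋ x x+a≋x+d+b)

-- Entries and rows of the adjacency matrix of the complement

module _ (n r : ℕ) (1≤r : 1 ≤ r) (r<n : r < n) where

  private
    N = 2 * n
    C = cycle N (3≤2n n r 1≤r r<n)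
    G = C⟨2n,r⟩ n r 1≤r r<n
    N≡n+n : N ≡ n + n
    N≡n+n = cong (n +_) (ℕ.+-identityʳ n)
    instance
      N≢0 : NonZero N
      N≢0 = ℕ.>-nonZero (ℕ.≤-trans (s≤s ℕ.z≤n) (3≤2n n r 1≤r r<n))

  entry : ℕ → ℕ → ℚ
  entry x d = adjacencyMatrix (complement G) (x mod N) ((x + d) mod N)

  -- By `walk-length`, a walk of length at most `r` would force `d ≤ r`. If the distance were `n`,
  -- the forward walk of length `d` and the backward walk of length `N ∸ d` would both have length
  -- at least `n`, forcing `d ≡ n`.
  entry≡1 : ∀ x {d} → r < d → d + r < N → d ≢ n → entry x d ≡ 1ℚ
  entry≡1 x {d} r<d d+r<N d≢n =
    cong (if_then 1ℚ else 0ℚ) (dec-true (adj? (complement G) (x mod N) ((x + d) mod N)) (u≢v , nonadjacent))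
    where
    too-short : ∀ {k} → k ≤ r → ¬ Walk C k (x mod N) ((x + d) mod N)
    too-short k≤r w = ℕ.<⇒≱ r<d (ℕ.≤-trans
      (walk-length (3≤2n n r 1≤r r<n) x w (ℕ.≤-<-trans (ℕ.+-monoʳ-≤ d k≤r) d+r<N)) k≤r)

    u≢v : x mod N ≢ (x + d) mod N
    u≢v u≡v = too-short ℕ.z≤n (subst (Walk C 0 (x mod N)) u≡v [])

    d≤N : d ≤ N
    d≤N = ℕ.≤-trans (ℕ.m≤m+n d r) (ℕ.<⇒≤ d+r<N)

    nonadjacent : ¬ Adj G (x mod N) ((x + d) mod N)
    nonadjacent (inj₁ (_ , k , s≤s k≤r , w , _)) = too-short k≤r w
    nonadjacent (inj₂ (_ , shortest)) = d≢n (ℕ.≤-antisym d≤n n≤d)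
      where
      n≤d : n ≤ d
      n≤d = ℕ.≮⇒≥ λ d<n → shortest d<n (walk-forward (3≤2n n r 1≤r r<n) d x)
      n≤N∸d : n ≤ N ∸ d
      n≤N∸d = ℕ.≮⇒≥ λ N∸d<n → shortest N∸d<n (walk-backward (3≤2n n r 1≤r r<n) d≤N x)
      d≤n : d ≤ n
      d≤n = ℕ.+-cancelʳ-≤ n d n (subst (d + n ≤_) (trans (ℕ.m+[n∸m]≡n d≤N) N≡n+n) (ℕ.+-monoʳ-≤ d n≤N∸d))

  entry≡0 : ∀ x d → (x mod N ≢ (x + d) mod N → Adj G (x mod N) ((x + d) mod N)) → entry x d ≡ 0ℚ
  entry≡0 x d adjacent = cong (if_then 1ℚ else 0ℚ)
    (dec-false (adj? (complement G) (x mod N) ((x + d) mod N)) λ (u≢v , ¬uv) → ¬uv (adjacent u≢v))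

  short-walk⇒adjacent : ∀ {k u v} → Walk C k u v → k ≤ r → u ≢ v → Adj G u v
  short-walk⇒adjacent {k} w k≤r u≢v =
    let d , d≤k , dist = walk⇒distance C k w in inj₁ (u≢v , d , s≤s (ℕ.≤-trans d≤k k≤r) , dist)

  entry≡0-near : ∀ x {d} → d ≤ r → entry x d ≡ 0ℚ
  entry≡0-near x {d} d≤r = entry≡0 x d (short-walk⇒adjacent (walk-forward (3≤2n n r 1≤r r<n) d x) d≤r)

  entry≡0-far : ∀ x {d} → d ≤ N → N ≤ d + r → entry x d ≡ 0ℚ
  entry≡0-far x {d} d≤N N≤d+r =
    entry≡0 x d (short-walk⇒adjacent (walk-backward (3≤2n n r 1≤r r<n) d≤N x) (ℕ.m≤n+o⇒m∸n≤o N d N≤d+r))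

  -- The forward walk has length `n`. A walk of length `k < n` satisfies `n + k < N`, so
  -- `walk-length` would give `n ≤ k`.
  entry≡0-antipodal : ∀ x → entry x n ≡ 0ℚ
  entry≡0-antipodal x = entry≡0 x n λ _ → inj₂ (w , λ {k} k<n w′ →
      ℕ.<⇒≱ k<n (walk-length (3≤2n n r 1≤r r<n) x w′ (subst (n + k <_) (sym N≡n+n) (ℕ.+-monoʳ-< n k<n))))
    where
    w : Walk C n (x mod N) ((x + n) mod N)
    w = walk-forward (3≤2n n r 1≤r r<n) n x

  -- N splits as (r + 1) + m + 1 + m + r; the two blocks of length m are the edges.
  complement-▹ : ∀ m → suc r + m ≡ n → ∀ {g} → Periodic N g → ∀ i →
    (adjacencyMatrix (complement G) ▹ (g ∘ toℕ)) (i mod N) ≡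
    ∑< m (λ k → g (i + suc r + k) ℚ.+ g (i + suc r + k + suc m))
  complement-▹ m refl {g} per i = begin
    (adjacencyMatrix (complement G) ▹ (g ∘ toℕ)) (i mod N)
      ≡⟨ ▹-rotate (adjacencyMatrix (complement G)) per i ⟩
    ∑< N h
      ≡⟨ cong (λ l → ∑< l h) (solveℕ 2 (λ r m → 1+ (r ⊞ m) ⊞ (1+ (r ⊞ m) ⊞ conℕ 0) ⊜
                                1+ r ⊞ (m ⊞ 1+ (m ⊞ r))) refl r m) ⟩
    ∑< (suc r + (m + suc (m + r))) h
      ≡⟨ trans (∑<-split (suc r) (m + suc (m + r)) h)
           (cong (∑< (suc r) h ℚ.+_) (∑<-split m (suc (m + r)) (λ k → h (suc r + k)))) ⟩
    ∑< (suc r) h ℚ.+ (block₁ ℚ.+ (h (suc r + (m + 0)) ℚ.+ ∑< (m + r) h′))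
      ≡⟨ cong (λ z → ∑< (suc r) h ℚ.+ (block₁ ℚ.+ (h (suc r + (m + 0)) ℚ.+ z))) (∑<-split m r h′) ⟩
    ∑< (suc r) h ℚ.+ (block₁ ℚ.+ (h (suc r + (m + 0)) ℚ.+ (∑< m h′ ℚ.+ ∑< r (λ k → h′ (m + k)))))
      ≡⟨ cong₂ ℚ._+_ (∑<-zero (suc r) near)
           (cong₂ ℚ._+_ (∑<-cong m edge₁) (cong₂ ℚ._+_ middle
             (cong₂ ℚ._+_ (∑<-cong m edge₂) (∑<-zero r far)))) ⟩
    0ℚ ℚ.+ (∑< m g₁ ℚ.+ (0ℚ ℚ.+ (∑< m g₂ ℚ.+ 0ℚ)))
      ≡⟨ trans (+-identityˡ _) (cong (∑< m g₁ ℚ.+_) (trans (+-identityˡ _) (+-identityʳ (∑< m g₂)))) ⟩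
    ∑< m g₁ ℚ.+ ∑< m g₂
      ≡⟨ ∑-distrib-+ {m} (g₁ ∘ toℕ) (g₂ ∘ toℕ) ⟨
    ∑< m (λ k → g₁ k ℚ.+ g₂ k) ∎
    where
    1+ : ∀ {k} → Polynomial k → Polynomial k
    1+ = conℕ 1 ⊞_

    h h′ g₁ g₂ : ℕ → ℚ
    h  d = entry i d ℚ.* g (i + d)
    -- The offset `suc r + m` is the antipode `n`; `suc k` makes `h′` start just after it.
    h′ k = h (suc r + (m + suc k))
    g₁ k = g (i + suc r + k)
    g₂ k = g (i + suc r + k + suc m)
    block₁ = ∑< m (λ k → h (suc r + k))

    h≡0 : ∀ {d} → entry i d ≡ 0ℚ → h d ≡ 0ℚ
    h≡0 {d} eq = trans (cong (ℚ._* g (i + d)) eq) (*-zeroˡ (g (i + d)))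

    h≡g : ∀ {d} → entry i d ≡ 1ℚ → h d ≡ g (i + d)
    h≡g {d} eq = trans (cong (ℚ._* g (i + d)) eq) (*-identityˡ (g (i + d)))

    near : ∀ k → k < suc r → h k ≡ 0ℚ
    near k (s≤s k≤r) = h≡0 (entry≡0-near i k≤r)

    edge₁ : ∀ k → k < m → h (suc r + k) ≡ g₁ k
    edge₁ k k<m = trans
      (h≡g (entry≡1 i (s≤s (ℕ.m≤m+n r k))
        (ℕ.+-mono-<-≤ (ℕ.+-monoʳ-< (suc r) k<m)
          (ℕ.≤-trans (ℕ.<⇒≤ r<n) (ℕ.m≤m+n n 0)))
        (λ eq → ℕ.<⇒≢ k<m (ℕ.+-cancelˡ-≡ (suc r) k m eq))))
      (cong g (sym (ℕ.+-assoc i (suc r) k)))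

    middle : h (suc r + (m + 0)) ≡ 0ℚ
    middle = trans (cong (λ l → h (suc r + l)) (ℕ.+-identityʳ m)) (h≡0 (entry≡0-antipodal i))

    edge₂ : ∀ k → k < m → h′ k ≡ g₂ k
    edge₂ k k<m = trans
      (h≡g (entry≡1 i (s≤s (ℕ.m≤m+n r _))
        (subst (_< N) (solveℕ 3 (λ r m k → (1+ r ⊞ m) ⊞ (1+ r ⊞ k) ⊜ (1+ r ⊞ (m ⊞ 1+ k)) ⊞ r) refl r m k)
          (ℕ.+-monoʳ-< n (ℕ.<-≤-trans (ℕ.+-monoʳ-< (suc r) k<m) (ℕ.m≤m+n n 0))))
        (λ eq → ℕ.m+1+n≢m m (ℕ.+-cancelˡ-≡ (suc r) (m + suc k) m eq))))
      (cong g (solveℕ 4 (λ i r m k → i ⊞ (1+ r ⊞ (m ⊞ 1+ k)) ⊜ i ⊞ 1+ r ⊞ k ⊞ 1+ m) refl i r m k))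

    far : ∀ k → k < r → h′ (m + k) ≡ 0ℚ
    far k k<r = h≡0 (entry≡0-far i
      (subst (_≤ N) (solveℕ 3 (λ r m k → (1+ r ⊞ m) ⊞ (1+ k ⊞ m) ⊜ 1+ r ⊞ (m ⊞ 1+ (m ⊞ k))) refl r m k)
        (ℕ.+-monoʳ-≤ n (ℕ.≤-trans (ℕ.+-monoˡ-≤ m (ℕ.m≤n⇒m≤1+n k<r)) (ℕ.m≤m+n n 0))))
      (subst (N ≤_) (solveℕ 3 (λ r m k → 1+ (r ⊞ m) ⊞ (1+ (r ⊞ m) ⊞ conℕ 0) ⊞ k ⊜
                       1+ r ⊞ (m ⊞ 1+ (m ⊞ k)) ⊞ r) refl r m k)
        (ℕ.m≤m+n N k)))

-- Solving the circulant equations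

sign : Parity → ℚ
sign 0ℙ = 1ℚ
sign 1ℙ = - 1ℚ

sign-suc : ∀ k → sign (parity (suc k)) ≡ - sign (parity k)
sign-suc zero          = refl
sign-suc (suc zero)    = refl
sign-suc (suc (suc k)) = sign-suc k

-- If y = x^s satisfies y^t = 1 with t odd, then (1 + y)(1 - y + y² - ⋯ + y^(t-1)) = 1 + y^t = 2.
1+shift-solvable : ∀ {N s t e} → Periodic N e → Periodic (t * s) e → parity t ≡ 1ℙ →
  ∃[ c ] Periodic N c × (∀ j → c j ℚ.+ c (j + s) ≡ e j)
1+shift-solvable {N} {s} {t} {e} per per-ts t-odd = c , c-periodic , c-solves
  where
  term : ℕ → ℕ → ℚ
  term k j = sign (parity k) ℚ.* e (j + k * s)

  c : ℕ → ℚ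
  c j = ½ ℚ.* ∑< t (λ k → term k j)

  c-periodic : Periodic N c
  c-periodic j = cong (½ ℚ.*_)
    (periodic-∑< t {term} (λ k i → cong (sign (parity k) ℚ.*_) (periodic-shift (k * s) per i)) j)

  module _ (j : ℕ) where
    F : ℕ → ℚ
    F k = sign (parity (suc k)) ℚ.* e (j + k * s)

    -- Shifting `j` by `s` moves to the next sample but keeps the sign, which is that of
    -- `F (suc k)`, as `parity` has period 2. The sum of the two terms is therefore a difference and
    -- telescopes.
    step : ∀ k → term k j ℚ.+ term k (j + s) ≡ F (suc k) - F k
    step k = begin
      term k j ℚ.+ term k (j + s)
        ≡⟨ cong (λ i → term k j ℚ.+ sign (parity k) ℚ.* e i) (ℕ.+-assoc j s (k * s)) ⟩
      term k j ℚ.+ F (suc k)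
        ≡⟨ solve 3 (λ σ x y → σ :* x :+ y := y :- (:- σ) :* x) refl
             (sign (parity k)) (e (j + k * s)) (F (suc k)) ⟩
      F (suc k) - - sign (parity k) ℚ.* e (j + k * s)
        ≡⟨ cong (λ σ → F (suc k) - σ ℚ.* e (j + k * s)) (sign-suc k) ⟨
      F (suc k) - F k ∎

    c-solves : c j ℚ.+ c (j + s) ≡ e j
    c-solves = begin
      c j ℚ.+ c (j + s)
        ≡⟨ *-distribˡ-+ ½ (∑< t (λ k → term k j)) (∑< t (λ k → term k (j + s))) ⟨
      ½ ℚ.* (∑< t (λ k → term k j) ℚ.+ ∑< t (λ k → term k (j + s)))
        ≡⟨ cong (½ ℚ.*_) (∑-distrib-+ {t} (λ k → term (toℕ k) j) (λ k → term (toℕ k) (j + s))) ⟨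
      ½ ℚ.* ∑< t (λ k → term k j ℚ.+ term k (j + s))
        ≡⟨ cong (½ ℚ.*_) (∑<-cong t λ k _ → step k) ⟩
      ½ ℚ.* ∑< t (λ k → F (suc k) - F k)
        ≡⟨ cong (½ ℚ.*_) (∑<-telescope t F) ⟩
      ½ ℚ.* (F t - F 0)
        ≡⟨ cong₂ (λ x y → ½ ℚ.* (x - y)) F-t F-0 ⟩
      ½ ℚ.* (e j - - 1ℚ ℚ.* e j)
        ≡⟨ solve 1 (λ x → con ½ :* (x :- (:- con 1ℚ) :* x) := x) refl (e j) ⟩
      e j ∎
      where
      F-0 : F 0 ≡ - 1ℚ ℚ.* e j
      F-0 = cong (λ i → - 1ℚ ℚ.* e i) (ℕ.+-identityʳ j)

      -- Odd `t` gives `F t` the sign +1, while `F 0` has the sign -1, so `F t - F 0` is twice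
      -- `e j`; the factor `½` is chosen for this.
      F-t : F t ≡ e j
      F-t = begin
        sign (parity (suc t)) ℚ.* e (j + t * s)
          ≡⟨ cong₂ ℚ._*_ (trans (sign-suc t) (cong (λ p → - sign p) t-odd)) (per-ts j) ⟩
        1ℚ ℚ.* e j
          ≡⟨ *-identityˡ (e j) ⟩
        e j ∎

-- If x^N = 1 and a (m + 1) = 1 + b N, then (1 + x + ⋯ + x^m)(1 + x^(m+1) + ⋯ + x^((a-1)(m+1)))
-- is 1 + x + ⋯ + x^(bN), which maps an N-periodic sequence c to c plus a constant; δ removes it.
geometric-solvable : ∀ {N c} m a b → a * suc m ≡ suc (b * N) → Periodic N c →
  ∃[ g ] Periodic N g × (∀ j → ∑< (suc m) (λ l → g (j + l)) ≡ c j)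
geometric-solvable {N} {c} m a b am≡1+bN per = g , g-periodic , g-solves
  where
  total : ℚ
  total = ∑< (b * N) c

  correction : ∃[ δ ] ∑< (suc m) (λ _ → δ) ≡ - total
  correction = ∑<-const-solvable m (- total)

  δ = proj₁ correction

  g₀ g : ℕ → ℚ
  g₀ j = ∑< a (λ k → c (j + k * suc m))
  g  j = g₀ j ℚ.+ δ

  g-periodic : Periodic N g
  g-periodic j = cong (ℚ._+ δ)
    (periodic-∑< a {λ k i → c (i + k * suc m)} (λ k → periodic-shift (k * suc m) per) j)

  per-bN : Periodic (b * N) c
  per-bN = periodic-multiple b per

  module _ (j : ℕ) where
    g₀-sum : ∑< (suc m) (λ l → g₀ (j + l)) ≡ total ℚ.+ c j
    g₀-sum = begin
      ∑< (suc m) (λ l → ∑< a λ k → c (j + l + k * suc m))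
        ≡⟨ ∑-comm {suc m} {a} (λ l k → c (j + toℕ l + toℕ k * suc m)) ⟩
      ∑< a (λ k → ∑< (suc m) λ l → c (j + l + k * suc m))
        ≡⟨ ∑<-cong a (λ k _ → ∑<-cong (suc m) λ l _ → cong c (begin
             j + l + k * suc m   ≡⟨ ℕ.+-assoc j l (k * suc m) ⟩
             j + (l + k * suc m) ≡⟨ cong (j +_) (ℕ.+-comm l (k * suc m)) ⟩
             j + (k * suc m + l) ∎)) ⟩
      ∑< a (λ k → ∑< (suc m) λ l → c (j + (k * suc m + l)))
        ≡⟨ ∑<-product a (suc m) (λ i → c (j + i)) ⟨
      ∑< (a * suc m) (λ i → c (j + i))
        ≡⟨ cong (λ l → ∑< l (λ i → c (j + i))) am≡1+bN ⟩
      ∑< (suc (b * N)) (λ i → c (j + i))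
        ≡⟨ ∑<-last (b * N) (λ i → c (j + i)) ⟩
      ∑< (b * N) (λ i → c (j + i)) ℚ.+ c (j + b * N)
        -- A window of `b * N` terms covers whole periods, so its sum is `total` for every `j`.
        -- Hence one constant `δ` corrects all positions.
        ≡⟨ cong₂ ℚ._+_ (∑<-rotate j per-bN) (per-bN j) ⟩
      total ℚ.+ c j ∎

    g-solves : ∑< (suc m) (λ l → g (j + l)) ≡ c j
    g-solves = begin
      ∑< (suc m) (λ l → g₀ (j + l) ℚ.+ δ)
        ≡⟨ ∑-distrib-+ {suc m} (λ l → g₀ (j + toℕ l)) (λ _ → δ) ⟩
      ∑< (suc m) (λ l → g₀ (j + l)) ℚ.+ ∑< (suc m) (λ _ → δ)
        ≡⟨ cong₂ ℚ._+_ g₀-sum (proj₂ correction) ⟩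
      total ℚ.+ c j ℚ.+ - total
        ≡⟨ solve 2 (λ x y → x :+ y :+ (:- x) := y) refl total (c j) ⟩
      c j ∎

coprime⇒inverse : ∀ {m N} → 2 ≤ N → Coprime m N → ∃[ a ] ∃[ b ] a * m ≡ suc (b * N)
coprime⇒inverse {m} {N} 2≤N m⊥N with coprime-Bézout m⊥N
... | Bézout.+- x y eq = x , y , sym eq
... | Bézout.-+ x y eq with x * m in xm
-- Here `y * N` would be 1, against `2 ≤ N`.
...   | zero  = contradiction (subst (2 ≤_) (ℕ.m*n≡1⇒n≡1 y N (sym eq)) 2≤N) λ { (s≤s ()) }
-- Squaring turns x m ≡ -1 into (x (x m)) m ≡ 1 modulo N.
...   | suc z = x * suc z , z * y , (begin
  x * suc z * m   ≡⟨ solveℕ 3 (λ x w m → x ⊠ w ⊠ m ⊜ w ⊠ (x ⊠ m)) refl x (suc z) m ⟩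
  suc z * (x * m) ≡⟨ cong (suc z *_) xm ⟩
  suc z * suc z   ≡⟨ solveℕ 1 (λ z → (conℕ 1 ⊞ z) ⊠ (conℕ 1 ⊞ z) ⊜
                                      conℕ 1 ⊞ z ⊠ (conℕ 2 ⊞ z)) refl z ⟩
  suc (z * suc (suc z)) ≡⟨ cong (λ w → suc (z * w)) eq ⟩
  suc (z * (y * N))     ≡⟨ cong suc (ℕ.*-assoc z y N) ⟨
  suc (z * y * N)       ∎)

-- Powers of 2

parity-even : ∀ {n} → parity n ≡ 0ℙ → ∃[ h ] n ≡ 2 * h
parity-even {zero}        _  = 0 , refl
parity-even {suc (suc n)} eq =
  let h , n≡2h = parity-even {n} eq in suc h , trans (cong (2 +_) n≡2h) (sym (ℕ.*-suc 2 h))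

2∣⇒parity-even : ∀ {n} → 2 ∣ n → parity n ≡ 0ℙ
2∣⇒parity-even (divides h refl) = trans (ℙ.*-homo-* h 2) (ℙ.*-zeroʳ (parity h))

odd⇒2∤ : ∀ {n} → parity n ≡ 1ℙ → ¬ 2 ∣ n
odd⇒2∤ odd 2∣n = contradiction (trans (sym odd) (2∣⇒parity-even 2∣n)) λ ()

2-adic-decomposition : ∀ n → 0 < n → ∃[ k ] ∃[ o ] n ≡ 2 ^ k * o × parity o ≡ 1ℙ
2-adic-decomposition = <-rec _ λ n rec 0<n → split n rec 0<n (parity n) refl
  where
  P : ℕ → Set
  P n = 0 < n → ∃[ k ] ∃[ o ] n ≡ 2 ^ k * o × parity o ≡ 1ℙ

  split : ∀ n → (∀ {h} → h < n → P h) → 0 < n → ∀ p → parity n ≡ p →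
    ∃[ k ] ∃[ o ] n ≡ 2 ^ k * o × parity o ≡ 1ℙ
  split n rec 0<n 1ℙ odd  = 0 , n , sym (ℕ.+-identityʳ n) , odd
  split n rec 0<n 0ℙ even with parity-even {n} even
  ... | suc h , refl =
    let k , o , eq , odd = rec {suc h} (ℕ.m<m+n (suc h) (s≤s z≤n)) (s≤s z≤n)
    in suc k , o , trans (cong (2 *_) eq) (sym (ℕ.*-assoc 2 (2 ^ k) o)) , odd

^-monoʳ-∣ : ∀ b {i j} → i ≤ j → b ^ i ∣ b ^ j
^-monoʳ-∣ b {i} i≤j with ℕ.m≤n⇒∃[o]m+o≡n i≤j
... | o , refl = subst (b ^ i ∣_) (sym (ℕ.^-distribˡ-+-* b i o)) (m∣m*n (b ^ o))

^-cancelʳ-< : ∀ b .{{_ : NonZero b}} i j → b ^ i < b ^ j → i < j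
^-cancelʳ-< b i j b^i<b^j = ℕ.≰⇒> λ j≤i → ℕ.<⇒≱ b^i<b^j (ℕ.^-monoʳ-≤ b {j} {i} j≤i)

-- If a power with exponent above `k` divided `2 ^ k * o`, so would `2 ^ suc k`, and cancelling
-- `2 ^ k` would leave 2 dividing the odd `o`.
isHighest : ∀ k {o} → parity o ≡ 1ℙ → IsHighestPowerOf2Dividing (2 ^ k) (2 ^ k * o)
isHighest k {o} odd = record
  { isPower = k , refl
  ; divides = m∣m*n o
  ; highest = λ i 2^i∣ → ℕ.^-monoʳ-≤ 2 {i} {k} (ℕ.≮⇒≥ λ k<i →
      odd⇒2∤ odd (*-cancelˡ-∣ (2 ^ k) {{ℕ.m^n≢0 2 k}}
      (subst (_∣ 2 ^ k * o) (ℕ.*-comm 2 (2 ^ k)) (∣-trans (^-monoʳ-∣ 2 {suc k} {i} k<i) 2^i∣))))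
  }

-- An even quotient would supply one more factor 2, so `2 ^ suc k` would divide `n` and exceed the
-- highest power.
isHighest⇒odd-quotient : ∀ {p n} (high : IsHighestPowerOf2Dividing p n) →
  parity (quotient (IsHighestPowerOf2Dividing.divides high)) ≡ 1ℙ
isHighest⇒odd-quotient {p} {n} high with IsHighestPowerOf2Dividing.isPower high
... | k , refl with parity (quotient (IsHighestPowerOf2Dividing.divides high)) in eq
...   | 1ℙ = refl
...   | 0ℙ = contradiction (IsHighestPowerOf2Dividing.highest high (suc k) 2^[1+k]∣n)
                           (ℕ.<⇒≱ (ℕ.^-monoʳ-< 2 (s≤s (s≤s z≤n)) {k} (ℕ.n<1+n k)))
  where
  t = quotient (IsHighestPowerOf2Dividing.divides high)
  h = proj₁ (parity-even {t} eq)

  2^[1+k]∣n : 2 ^ suc k ∣ n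
  2^[1+k]∣n = divides h (begin
    n               ≡⟨ _∣_.equality (IsHighestPowerOf2Dividing.divides high) ⟩
    t * 2 ^ k       ≡⟨ cong (_* 2 ^ k) (proj₂ (parity-even {t} eq)) ⟩
    2 * h * 2 ^ k   ≡⟨ cong (_* 2 ^ k) (ℕ.*-comm 2 h) ⟩
    h * 2 * 2 ^ k   ≡⟨ ℕ.*-assoc h 2 (2 ^ k) ⟩
    h * (2 * 2 ^ k) ∎)

-- Kernel vectors

parity-of-quotient : ∀ w .{{_ : NonZero w}} i o → parity ((i + w * o) / w) ≡ parity (i / w) ℙ.+ parity o
parity-of-quotient w i o = begin
  parity ((i + w * o) / w)    ≡⟨ cong parity (+-distrib-/-∣ʳ i (m∣m*n o)) ⟩
  parity (i / w + w * o / w)  ≡⟨ cong (λ x → parity (i / w + x / w)) (ℕ.*-comm w o) ⟩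
  parity (i / w + o * w / w)  ≡⟨ cong (λ x → parity (i / w + x)) (m*n/n≡m o w) ⟩
  parity (i / w + o)          ≡⟨ ℙ.+-homo-+ (i / w) o ⟩
  parity (i / w) ℙ.+ parity o ∎

-- The witness is the square wave (-1)^⌊i/w⌋. A shift by `w * o` adds `o` to the quotient, so an odd
-- multiple of `w` flips the sign and an even multiple preserves it.
antiperiodic : ∀ w .{{_ : NonZero w}} o e → parity o ≡ 1ℙ → parity e ≡ 0ℙ →
  ∃[ x ] Periodic (w * e) x × (∀ i → x (i + w * o) ≡ - x i) × x 0 ≡ 1ℚ
antiperiodic w o e odd even = x ,
  (λ i → cong sign (trans (parity-of-quotient w i e)
    (trans (cong (parity (i / w) ℙ.+_) even) (ℙ.+-identityʳ (parity (i / w)))))) ,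
  (λ i → trans (cong sign (trans (parity-of-quotient w i o) (cong (parity (i / w) ℙ.+_) odd)))
    (sign-+1 (parity (i / w)))) ,
  cong (λ k → sign (parity k)) (0/n≡0 w)
  where
  x : ℕ → ℚ
  x i = sign (parity (i / w))

  sign-+1 : ∀ p → sign (p ℙ.+ 1ℙ) ≡ - sign p
  sign-+1 0ℙ = refl
  sign-+1 1ℙ = refl

multiple? : ℕ → ℕ → ℚ
multiple? d i = if does (d ∣? i) then 1ℚ else 0ℚ

multiple?-periodic : ∀ {d p} → d ∣ p → Periodic p (multiple? d)
multiple?-periodic {d} {p} d∣p i = cong (if_then 1ℚ else 0ℚ) (does-⇔ (mk⇔
  (λ d∣i+p → ∣m+n∣m⇒∣n (subst (d ∣_) (ℕ.+-comm i p) d∣i+p) d∣p)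
  (λ d∣i → ∣m∣n⇒∣m+n d∣i d∣p)) (d ∣? (i + p)) (d ∣? i))

-- Necessary and sufficient conditions for invertibility

module _ (n r : ℕ) (1≤r : 1 ≤ r) (r<n : r < n) (m : ℕ) (n≡1+r+m : suc r + m ≡ n) where
  private
    N = 2 * n
    A : Matrix N
    A = adjacencyMatrix (complement (C⟨2n,r⟩ n r 1≤r r<n))

    instance
      N≢0 : NonZero N
      N≢0 = ℕ.>-nonZero (ℕ.≤-trans (s≤s ℕ.z≤n) (3≤2n n r 1≤r r<n))

  -- Turns a periodic sequence killed by the circulant, but nonzero at 0, into a contradiction with
  -- non-singularity. The window may start at any `j`, so the offset `suc r` in `complement-▹` is
  -- just one instance.
  kernel-vanishes-at-0 : NonSingularMatrix A → ∀ {x} → Periodic N x →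
    (∀ j → ∑< m (λ k → x (j + k) ℚ.+ x (j + k + suc m)) ≡ 0ℚ) → x 0 ≡ 0ℚ
  kernel-vanishes-at-0 nonsingular {x} per Ax≡0 =
    trans (cong x (sym (trans (toℕ-mod 0) (m*n%n≡0 0 N))))
      (kernel-trivial nonsingular (x ∘ toℕ) Ax≡0′ (0 mod N))
    where
    Ax≡0′ : ∀ u → (A ▹ (x ∘ toℕ)) u ≡ 0ℚ
    Ax≡0′ u = begin
      (A ▹ (x ∘ toℕ)) u
        ≡⟨ cong (A ▹ (x ∘ toℕ)) (mod-toℕ u) ⟨
      (A ▹ (x ∘ toℕ)) (toℕ u mod N)
        ≡⟨ complement-▹ n r 1≤r r<n m n≡1+r+m per (toℕ u) ⟩
      ∑< m (λ k → x (toℕ u + suc r + k) ℚ.+ x (toℕ u + suc r + k + suc m))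
        ≡⟨ Ax≡0 (toℕ u + suc r) ⟩
      0ℚ ∎

  nonsingular⇒gcd≡1 : NonSingularMatrix A → gcd n (suc r) ≡ 1
  nonsingular⇒gcd≡1 nonsingular with gcd n (suc r) in eq
  ... | d with d ℕ.≟ 1
  ...   | yes d≡1 = d≡1
  ...   | no  d≢1 = contradiction
    (kernel-vanishes-at-0 nonsingular x-periodic x-kernel)
    λ x0≡0 → -1≢0 (trans (sym x0≡-1) x0≡0)
    where
    g x : ℕ → ℚ
    g = multiple? d
    -- A difference sequence: its sum over `m` consecutive terms telescopes to `g (j + m) - g j`,
    -- which is zero because `d` divides `m`.
    x i = g (suc i) - g i

    d∣n : d ∣ n
    d∣n = subst (_∣ n) eq (gcd[m,n]∣m n (suc r))

    d∣m : d ∣ m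
    d∣m = ∣m+n∣m⇒∣n (subst (d ∣_) (sym n≡1+r+m) d∣n) (subst (_∣ suc r) eq (gcd[m,n]∣n n (suc r)))

    x-periodic : Periodic N x
    x-periodic i = cong₂ _-_ (g-periodic (suc i)) (g-periodic i)
      where
      g-periodic : Periodic N g
      g-periodic = multiple?-periodic (∣n⇒∣m*n 2 d∣n)

    x-sum : ∀ j → ∑< m (λ k → x (j + k)) ≡ 0ℚ
    x-sum j = begin
      ∑< m (λ k → g (suc (j + k)) - g (j + k))
        ≡⟨ ∑<-cong m (λ k _ → cong (λ i → g i - g (j + k)) (sym (ℕ.+-suc j k))) ⟩
      ∑< m (λ k → g (j + suc k) - g (j + k))
        ≡⟨ ∑<-telescope m (λ k → g (j + k)) ⟩
      g (j + m) - g (j + 0)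
        ≡⟨ cong₂ (λ y i → y - g i) (multiple?-periodic d∣m j) (ℕ.+-identityʳ j) ⟩
      g j - g j
        ≡⟨ +-inverseʳ (g j) ⟩
      0ℚ ∎

    x-kernel : ∀ j → ∑< m (λ k → x (j + k) ℚ.+ x (j + k + suc m)) ≡ 0ℚ
    x-kernel j = begin
      ∑< m (λ k → x (j + k) ℚ.+ x (j + k + suc m))
        ≡⟨ ∑-distrib-+ {m} (λ k → x (j + toℕ k)) (λ k → x (j + toℕ k + suc m)) ⟩
      ∑< m (λ k → x (j + k)) ℚ.+ ∑< m (λ k → x (j + k + suc m))
        ≡⟨ cong₂ ℚ._+_ (x-sum j) (trans (∑<-cong m λ k _ → cong x (swap k)) (x-sum (j + suc m))) ⟩
      0ℚ ∎
      where
      swap : ∀ k → j + k + suc m ≡ j + suc m + k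
      swap k = trans (ℕ.+-assoc j k (suc m))
        (trans (cong (j +_) (ℕ.+-comm k (suc m))) (sym (ℕ.+-assoc j (suc m) k)))

    -- Since `d` is not 1, it does not divide 1, while it divides 0; the value is 0 - 1.
    x0≡-1 : x 0 ≡ - 1ℚ
    x0≡-1 = cong₂ (λ a b → (if a then 1ℚ else 0ℚ) - (if b then 1ℚ else 0ℚ))
      (dec-false (d ∣? 1) λ d∣1 → d≢1 (∣1⇒≡1 d∣1)) (dec-true (d ∣? 0) (d ∣0))

    -1≢0 : - 1ℚ ≢ 0ℚ
    -1≢0 ()

  -- If `l ≤ j`, then `2 ^ l` divides `n`, and the square wave with blocks of length `2 ^ l` is
  -- `N`-periodic. The shift by `suc m`, an odd multiple of `2 ^ l`, negates it, so the row sums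
  -- cancel term by term.
  nonsingular⇒2-adic : NonSingularMatrix A → ∀ {j l o o′} → parity o′ ≡ 1ℙ →
    n ≡ 2 ^ j * o → suc m ≡ 2 ^ l * o′ → j < l
  nonsingular⇒2-adic nonsingular {j} {l} {o} {o′} odd n≡ s≡ = ℕ.≰⇒> λ l≤j → absurd (ℕ.m≤n⇒∃[o]m+o≡n l≤j)
    where
    absurd : ¬ (∃[ i ] l + i ≡ j)
    absurd (i , refl) = 1≢0 (trans (sym x0≡1) (kernel-vanishes-at-0 nonsingular x-periodic x-kernel))
      where
      -- The cofactor of `2 ^ l` in `N` is even because of the factor 2 in `N = 2 * n`, whatever the
      -- parity of `2 ^ i * o`.
      solution = antiperiodic (2 ^ l) {{ℕ.m^n≢0 2 l}} o′ (2 * (2 ^ i * o)) odd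
        (2∣⇒parity-even (m∣m*n (2 ^ i * o)))
      x = proj₁ solution
      x-antiperiodic = proj₁ (proj₂ (proj₂ solution))
      x0≡1 = proj₂ (proj₂ (proj₂ solution))

      N≡ : 2 ^ l * (2 * (2 ^ i * o)) ≡ N
      N≡ = begin
        2 ^ l * (2 * (2 ^ i * o)) ≡⟨ solveℕ 3 (λ a b c → a ⊠ (conℕ 2 ⊠ (b ⊠ c)) ⊜ conℕ 2 ⊠ (a ⊠ b ⊠ c))
                                         refl (2 ^ l) (2 ^ i) o ⟩
        2 * (2 ^ l * 2 ^ i * o) ≡⟨ cong (λ w → 2 * (w * o)) (ℕ.^-distribˡ-+-* 2 l i) ⟨
        2 * (2 ^ (l + i) * o)   ≡⟨ cong (2 *_) n≡ ⟨
        N                       ∎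

      x-periodic : Periodic N x
      x-periodic = subst (λ p → Periodic p x) N≡ (proj₁ (proj₂ solution))

      x-kernel : ∀ j → ∑< m (λ k → x (j + k) ℚ.+ x (j + k + suc m)) ≡ 0ℚ
      x-kernel j = ∑<-zero m λ k _ → begin
        x (j + k) ℚ.+ x (j + k + suc m)      ≡⟨ cong (λ s → x (j + k) ℚ.+ x (j + k + s)) s≡ ⟩
        x (j + k) ℚ.+ x (j + k + 2 ^ l * o′) ≡⟨ cong (x (j + k) ℚ.+_) (x-antiperiodic (j + k)) ⟩
        x (j + k) ℚ.+ - x (j + k)            ≡⟨ +-inverseʳ (x (j + k)) ⟩
        0ℚ                                   ∎

  -- The two factors of the circulant are inverted in turn: `c` solves the geometric sum and `g`
  -- then solves 1 + shift. The resulting surjectivity suffices since the adjacency matrix is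
  -- symmetric.
  solvable⇒nonsingular : ∀ {t k a b} → parity t ≡ 1ℙ → t * suc m ≡ k * N →
    a * m ≡ suc (b * N) → NonSingularMatrix A
  solvable⇒nonsingular {t} {k} {a} {b} odd ts≡kN am≡1+bN =
    symmetric∧surjective⇒nonSingular (adjacencyMatrix-sym (complement (C⟨2n,r⟩ n r 1≤r r<n)))
      (surjective m refl am≡1+bN)
    where
    surjective : ∀ m′ → m ≡ m′ → a * m′ ≡ suc (b * N) → ∀ y → ∃[ x ] ∀ u → (A ▹ x) u ≡ y u
    -- For `m = 0` the equation `a * m ≡ suc (b * N)` would equate 0 with a successor.
    surjective zero     _    eq = contradiction (trans (sym (ℕ.*-zeroʳ a)) eq) λ ()
    surjective (suc m′) refl eq y = g ∘ toℕ , solves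
      where
      e e′ : ℕ → ℚ
      e  i = y (i mod N)
      -- Undoes the offset `suc r` in `complement-▹`: together the two shifts make a full period
      -- `N`.
      e′ i = e (i + (N ∸ suc r))

      e′-periodic : Periodic N e′
      e′-periodic = periodic-shift (N ∸ suc r) (periodic-mod y)

      step₁ = geometric-solvable m′ a b eq e′-periodic
      c = proj₁ step₁
      c-periodic = proj₁ (proj₂ step₁)

      step₂ = 1+shift-solvable {s = suc m} {t} c-periodic
        (subst (λ p → Periodic p c) (sym ts≡kN) (periodic-multiple k c-periodic)) odd
      g = proj₁ step₂

      1+r≤N : suc r ≤ N
      1+r≤N = ℕ.≤-trans r<n (ℕ.m≤m+n n (n + 0))

      solves : ∀ u → (A ▹ (g ∘ toℕ)) u ≡ y u
      solves u = begin
        (A ▹ (g ∘ toℕ)) u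
          ≡⟨ cong (A ▹ (g ∘ toℕ)) (mod-toℕ u) ⟨
        (A ▹ (g ∘ toℕ)) (toℕ u mod N)
          ≡⟨ complement-▹ n r 1≤r r<n m n≡1+r+m (proj₁ (proj₂ step₂)) (toℕ u) ⟩
        ∑< m (λ k → g (j + k) ℚ.+ g (j + k + suc m))
          ≡⟨ ∑<-cong m (λ k _ → proj₂ (proj₂ step₂) (j + k)) ⟩
        ∑< m (λ k → c (j + k))
          ≡⟨ proj₂ (proj₂ step₁) j ⟩
        e (toℕ u + suc r + (N ∸ suc r))
          ≡⟨ cong e (trans (ℕ.+-assoc (toℕ u) (suc r) (N ∸ suc r))
                           (cong (toℕ u +_) (ℕ.m+[n∸m]≡n 1+r≤N))) ⟩
        e (toℕ u + N)
          ≡⟨ periodic-mod y (toℕ u) ⟩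
        y (toℕ u mod N)
          ≡⟨ cong y (mod-toℕ u) ⟩
        y u ∎
        where j = toℕ u + suc r

-- Assembling the equivalence

-- Since `suc m` is even, a divisor `d` of `m` is coprime to 2. Hence `d ∣ 2 * n` gives `d ∣ n`, and
-- `d` also divides the difference `suc r` of `n` and `m`, so it divides their gcd.
coprime-double : ∀ {m n r} → suc r + m ≡ n → 2 ∣ suc m → gcd n (suc r) ≡ 1 → Coprime m (2 * n)
coprime-double {m} {n} {r} refl 2∣s gcd≡1 {d} (d∣m , d∣2n) = gcd≡1⇒coprime gcd≡1 (d∣n , d∣1+r)
  where
  d⊥2 : Coprime d 2
  d⊥2 {e} (e∣d , e∣2) = ∣1⇒≡1 (∣m+n∣m⇒∣n
    (subst (e ∣_) (ℕ.+-comm 1 m) (∣-trans e∣2 2∣s)) (∣-trans e∣d d∣m))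

  d∣n : d ∣ n
  d∣n = coprime-divisor d⊥2 d∣2n

  d∣1+r : d ∣ suc r
  d∣1+r = ∣m+n∣m⇒∣n (subst (d ∣_) (ℕ.+-comm (suc r) m) d∣n) d∣m

lemma22 : (n r : ℕ) (1≤r : 1 ≤ r) (r<n : r < n) →
  NonSingular (complement (C⟨2n,r⟩ n r 1≤r r<n)) ⇔
    ( parity n ≡ parity r
    × gcd n (r + 1) ≡ 1
    × (∃[ p ] ∃[ q ] IsHighestPowerOf2Dividing p n
                   × IsHighestPowerOf2Dividing q (n ∸ r)
                   × p < q) )
lemma22 n r 1≤r r<n = mk⇔ forward backward
  where
  m s : ℕ
  m = n ∸ suc r
  s = n ∸ r

  n≡1+r+m : suc r + m ≡ n
  n≡1+r+m = ℕ.m+[n∸m]≡n r<n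

  s≡1+m : s ≡ suc m
  s≡1+m = ℕ.+-∸-assoc 1 r<n

  2∣s⇒parity : 2 ∣ s → parity n ≡ parity r
  2∣s⇒parity 2∣s = begin
    parity n              ≡⟨ cong parity (ℕ.m+[n∸m]≡n (ℕ.<⇒≤ r<n)) ⟨
    parity (r + s)        ≡⟨ ℙ.+-homo-+ r s ⟩
    parity r ℙ.+ parity s ≡⟨ cong (parity r ℙ.+_) (2∣⇒parity-even 2∣s) ⟩
    parity r ℙ.+ 0ℙ       ≡⟨ ℙ.+-identityʳ (parity r) ⟩
    parity r              ∎

  forward : NonSingular (complement (C⟨2n,r⟩ n r 1≤r r<n)) → _
  forward nonsingular =
    let j , o  , n≡ , o-odd  = 2-adic-decomposition n (ℕ.≤-trans (s≤s z≤n) r<n)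
        l , o′ , s≡ , o′-odd = 2-adic-decomposition s (ℕ.m<n⇒0<n∸m r<n)
        j<l = nonsingular⇒2-adic n r 1≤r r<n m n≡1+r+m nonsingular {j} {l}
                o′-odd n≡ (trans (sym s≡1+m) s≡)
        -- From `j < l` the exponent `l` is positive, so `n ∸ r` is even and `n` and `r` have equal
        -- parity.
        2∣2^l = ^-monoʳ-∣ 2 {1} {l} (ℕ.≤-trans (s≤s z≤n) j<l)
    in 2∣s⇒parity (subst (2 ∣_) (sym s≡) (∣m⇒∣m*n o′ 2∣2^l))
     , subst (λ k → gcd n k ≡ 1) (ℕ.+-comm 1 r) (nonsingular⇒gcd≡1 n r 1≤r r<n m n≡1+r+m nonsingular)
     , 2 ^ j , 2 ^ l
     , subst (IsHighestPowerOf2Dividing (2 ^ j)) (sym n≡) (isHighest j {o} o-odd)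
     , subst (IsHighestPowerOf2Dividing (2 ^ l)) (sym s≡) (isHighest l {o′} o′-odd)
     , ℕ.^-monoʳ-< 2 (s≤s (s≤s z≤n)) {j} {l} j<l

  backward : _ → NonSingular (complement (C⟨2n,r⟩ n r 1≤r r<n))
  backward (_ , gcd≡1 , p , q , p-high , q-high , p<q)
    with IsHighestPowerOf2Dividing.isPower p-high | IsHighestPowerOf2Dividing.isPower q-high
  ... | j , refl | l , refl =
    let a , b , am≡1+bN = coprime⇒inverse
          (ℕ.≤-trans (s≤s (s≤s z≤n)) (3≤2n n r 1≤r r<n))
          (coprime-double n≡1+r+m 2∣1+m (subst (λ k → gcd n k ≡ 1) (ℕ.+-comm r 1) gcd≡1))
    in solvable⇒nonsingular n r 1≤r r<n m n≡1+r+m {t} {k} {a} {b}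
         (isHighest⇒odd-quotient p-high) ts≡kN am≡1+bN
    where
    2p∣q : 2 * 2 ^ j ∣ 2 ^ l
    2p∣q = ^-monoʳ-∣ 2 {suc j} {l} (^-cancelʳ-< 2 j l p<q)

    2p∣s : 2 * 2 ^ j ∣ suc m
    2p∣s = subst (2 * 2 ^ j ∣_) s≡1+m (∣-trans 2p∣q (IsHighestPowerOf2Dividing.divides q-high))

    2∣1+m : 2 ∣ suc m
    2∣1+m = ∣-trans (m∣m*n (2 ^ j)) 2p∣s

    -- The odd part of `n`: `t * 2 ^ j` is `n`, and `suc m` is `k` times `2 * 2 ^ j`, so `t * suc m`
    -- is `k` times `2 * n`.
    t = quotient (IsHighestPowerOf2Dividing.divides p-high)
    k = quotient 2p∣s

    ts≡kN : t * suc m ≡ k * (2 * n)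
    ts≡kN = begin
      t * suc m             ≡⟨ cong (t *_) (_∣_.equality 2p∣s) ⟩
      t * (k * (2 * 2 ^ j)) ≡⟨ solveℕ 3 (λ t k p → t ⊠ (k ⊠ (conℕ 2 ⊠ p)) ⊜ k ⊠ (conℕ 2 ⊠ (t ⊠ p)))
                                    refl t k (2 ^ j) ⟩
      k * (2 * (t * 2 ^ j)) ≡⟨ cong (λ w → k * (2 * w))
                                    (_∣_.equality (IsHighestPowerOf2Dividing.divides p-high)) ⟨
      k * (2 * n)           ∎
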